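{- For all integers $n\ge 0$, $$F_{n+1}^2=C_n+\sum_{k=2}^nF^2_{k-1}C_{n-k}+\sum_{k=3}^n\sum_{l=3}^k(2-\delta_{l,3})F^2_{k-l+1}C_{n-k},$$ where $C_n$ is the number of ways to tile an $n$-board using half-squares and $(\frac12,\frac12)$-fences such that no bifences occur.
   Context: The Fibonacci numbers are $F_0=0$, $F_1=1$, $F_n=F_{n-1}+F_{n-2}$ for $n\ge2$. $\delta_{i,j}$ is $1$ if $i=j$ and $0$ otherwise. Empty sums are $0$. An $n$-board is a $1\times n$ array of $n$ unit square cells in a row (horizontal extent $[0,n]$). A half-square is a tile of width $\frac12$ and height $1$, covering a horizontal interval $[x,x+\frac12]$. A $(\frac12,\frac12)$-fence is a single tile composed of two pieces (posts), each of width $\frac12$ and height $1$, separated by a gap of width $\frac12$; it covers $[x,x+\frac12]\cup[x+1,x+\frac32]$ for some $x$. Tiles are not rotated. Tiles need not be aligned with the cell boundaries, and the gap of a fence must be covered by other tiles. A tiling covers the board exactly, with no overlaps (of interiors), no uncovered region and nothing protruding from the board. There is exactly one (empty) tiling of the $0$-board. A bifence is a pair of interlocking fences, i.e. fences starting at $x$ and $x+\frac12$, together covering exactly $[x,x+2]$ (here $x$ need not be an integer). The numbers $C_n$ satisfy $C_0=C_1=1$, $C_2=3$ and $C_n=C_{n-1}+2C_{n-2}+C_{n-3}$ for $n\ge3$.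
   Formalization: The horizontal positions x of the half-squares and fences, and the points of the board to be covered, are taken to be rational rather than real numbers. -}

module Defs where

open import Data.Bool using (if_then_else_)
open import Data.Integer using (+_)
open import Data.List using (List; []; _∷_; map; upTo; length)
open import Data.List.Membership.Propositional using (_∈_)
open import Data.List.Relation.Unary.Any using (Any)
open import Data.List.Relation.Unary.AllPairs using (AllPairs)
open import Data.List.Relation.Unary.Unique.Propositional using (Unique)
open import Data.Nat as ℕ using (ℕ; zero; suc; _∸_)
open import Data.Nat.ListAction using (sum)
open import Data.Product using (∃-syntax; _×_)
open import Data.Rational using (ℚ; 0ℚ; 1ℚ; ½; _+_; _≤_; _<_; _/_)
open import Function.Bundles using (_⇔_)
open import Relation.Binary.PropositionalEquality using (_≡_)
open import Relation.Nullary using (¬_; does)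

F : ℕ → ℕ
F 0             = 0
F 1             = 1
F (suc (suc n)) = F (suc n) ℕ.+ F n

δ : ℕ → ℕ → ℕ
δ i j = if does (i ℕ.≟ j) then 1 else 0

-- The sum of f k over a ≤ k ≤ b, which is 0 when b < a.
sumFromTo : ℕ → ℕ → (ℕ → ℕ) → ℕ
sumFromTo a b f = sum (map (λ i → f (a ℕ.+ i)) (upTo (suc b ∸ a)))

infix 5 sumFromTo
syntax sumFromTo a b (λ k → e) = ∑[ k ∈ a ⋯ b ] e

data Shape : Set where
  halfSquare fence : Shape

-- A tile is placed by the horizontal coordinate of its left edge.  This may be
-- any rational number: alignment to a grid is not assumed.
record Tile : Set where
  constructor _at_
  field
    shape : Shape
    start : ℚ

open Tile public

-- The left ends of the pieces of a tile, each piece having width ½.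
posts : Tile → List ℚ
posts (halfSquare at x) = x ∷ []
posts (fence      at x) = x ∷ x + 1ℚ ∷ []

Covers : Tile → ℚ → Set
Covers t p = Any (λ a → a ≤ p × p ≤ a + ½) (posts t)

CoversInside : Tile → ℚ → Set
CoversInside t p = Any (λ a → a < p × p < a + ½) (posts t)

fromℕ : ℕ → ℚ
fromℕ n = + n / 1

-- Tilings of the board [0, n].  A tiling is a finite set of tiles, represented
-- by the list of its elements from left to right, so that different lists are
-- different tilings; two tiles with the same start would overlap, hence the
-- strict order.  Only points with 0 < p < n have to be covered: tiles being
-- closed, the end points are then covered too if n > 0, while the 0-board is
-- tiled by the empty list.
record IsTiling (n : ℕ) (T : List Tile) : Set where
  field
    ordered   : AllPairs (λ s t → start s < start t) T
    within    : ∀ {t} → t ∈ T → ∀ p → Covers t p → 0ℚ ≤ p × p ≤ fromℕ n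
    covered   : ∀ p → 0ℚ < p → p < fromℕ n → ∃[ t ] (t ∈ T × Covers t p)
    noOverlap : ∀ {s t} → s ∈ T → t ∈ T →
                ∀ p → CoversInside s p → CoversInside t p → s ≡ t

HasBifence : List Tile → Set
HasBifence T = ∃[ x ] ((fence at x) ∈ T × (fence at (x + ½)) ∈ T)

IsBifenceFreeTiling : ℕ → List Tile → Set
IsBifenceFreeTiling n T = IsTiling n T × ¬ HasBifence T

-- Exactly k elements of A satisfy P.
HasCount : {A : Set} → (A → Set) → ℕ → Set
HasCount {A} P k =
  ∃[ xs ] (Unique {A = A} xs × (∀ x → x ∈ xs ⇔ P x) × length xs ≡ k)

{-# OPTIONS --safe #-}
module Submission where

-- In a bifence-free tiling the gap of every fence is covered by a half-square:
-- the tile that starts where the gap does is otherwise a fence, completing a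
-- bifence.  Hence such a tiling is a sequence of half-squares (half a cell) and
-- filled fences (three half-cells), and the number b m of these on m half-cells
-- satisfies b (m + 3) = b (m + 2) + b m, so that C n = b (2n) satisfies
-- C (n + 3) = C (n + 2) + 2 C (n + 1) + C n.  Collecting the factors of C (n - k)
-- and using Σ F i ² = F m F (m + 1), the identity becomes
--   F (n + 1) ² = C n + Σ_j c j C (n - 2 - j),
--   c j = F (j + 1) ² + F j ² + 2 F (j - 1) F j,
-- which follows by induction from the recurrence of C.

open import Defs
open import Data.Nat using (ℕ; _+_; _*_; _∸_; _^_)
open import Data.Product using (Σ; _×_)
open import Relation.Binary.PropositionalEquality using (_≡_)

open import Data.Empty using (⊥; ⊥-elim)
open import Data.List using (List; []; _∷_; _++_; map; length; applyUpTo)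
open import Data.List.Membership.Propositional using (_∈_; find; lose)
open import Data.List.Membership.Propositional.Properties using (∈-map⁺; ∈-map⁻; ∈-++⁺ˡ; ∈-++⁺ʳ; ∈-++⁻)
open import Data.List.Properties using (∷-injectiveʳ; length-++; length-map; map-upTo)
open import Data.List.Relation.Unary.All as All using ([]; _∷_)
open import Data.List.Relation.Unary.AllPairs as AllPairs using (AllPairs; []; _∷_)
open import Data.List.Relation.Unary.Any using (Any; here; there)
open import Data.List.Relation.Unary.Unique.Propositional using (Unique)
open import Data.Nat using (zero; suc)
open import Data.Nat.ListAction using (sum)
open import Data.Nat.Tactic.RingSolver using (solve-∀)
open import Data.Product using (∃-syntax; ∃₂; _,_; proj₁; proj₂)
open import Data.Rational using (ℚ; 0ℚ; 1ℚ; ½)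
open import Data.Sum using (_⊎_; inj₁; inj₂)
open import Function using (_∘_; case_of_)
open import Function.Bundles using (mk⇔)
open import Relation.Binary.PropositionalEquality using (refl; sym; trans; cong; cong₂; subst; _≢_; module ≡-Reasoning)
open import Relation.Nullary using (¬_; yes; no; contradiction)
import Data.Integer as ℤ
import Data.List.Relation.Unary.AllPairs.Properties as AllPairsₚ
import Data.List.Relation.Unary.Unique.Propositional.Properties as Uniqueₚ
import Data.Nat.Properties as ℕₚ
import Data.Rational as ℚ
import Data.Rational.Properties as ℚₚ
import Data.Rational.Unnormalised as ℚᵘ
import Data.Rational.Unnormalised.Properties as ℚᵘₚ

-- Positions

infixl 8 _⁺

_⁺ : ℚ → ℚ
a ⁺ = a ℚ.+ ½

-- The half steps accumulate in the base point, so the right end `shift a (suc m)` is by reduction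
-- the right end `shift (a ⁺) m` of what follows a half-square at `a`.
shift : ℚ → ℕ → ℚ
shift a zero    = a
shift a (suc m) = shift (a ⁺) m

a<a⁺ : ∀ a → a ℚ.< a ⁺
a<a⁺ a = subst (ℚ._< a ⁺) (ℚₚ.+-identityʳ a) (ℚₚ.+-monoʳ-< a (ℚₚ.positive⁻¹ ½))

a≤a⁺ : ∀ a → a ℚ.≤ a ⁺
a≤a⁺ a = ℚₚ.<⇒≤ (a<a⁺ a)

⁺-mono-≤ : ∀ {a b} → a ℚ.≤ b → a ⁺ ℚ.≤ b ⁺
⁺-mono-≤ = ℚₚ.+-monoˡ-≤ ½

+1≡⁺⁺ : ∀ a → a ℚ.+ 1ℚ ≡ a ⁺ ⁺
+1≡⁺⁺ a = sym (ℚₚ.+-assoc a ½ ½)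

<⇒≱ : ∀ {p q} → p ℚ.< q → ¬ q ℚ.≤ p
<⇒≱ p<q q≤p = ℚₚ.<-irrefl refl (ℚₚ.<-≤-trans p<q q≤p)

≤-shift : ∀ a m → a ℚ.≤ shift a m
≤-shift a zero    = ℚₚ.≤-refl
≤-shift a (suc m) = ℚₚ.≤-trans (a≤a⁺ a) (≤-shift (a ⁺) m)

-- Normalisation of `+ n / 1` is stuck on a variable `n`; among unnormalised fractions the
-- denominators stay 1 and only arithmetic of numerators remains.
fromℕ-suc : ∀ n → fromℕ (suc n) ≡ 1ℚ ℚ.+ fromℕ n
fromℕ-suc n = ℚₚ.toℚᵘ-injective (begin
  ℚ.toℚᵘ (fromℕ (suc n))               ≈⟨ ℚₚ.toℚᵘ-fromℚᵘ (frac (suc n)) ⟩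
  frac (suc n)                         ≈⟨ frac-suc n ⟩
  frac 1 ℚᵘ.+ frac n                   ≈⟨ ℚᵘₚ.+-congʳ (frac 1) (ℚᵘₚ.≃-sym (ℚₚ.toℚᵘ-fromℚᵘ (frac n))) ⟩
  frac 1 ℚᵘ.+ ℚ.toℚᵘ (fromℕ n)         ≈⟨ ℚᵘₚ.≃-sym (ℚₚ.toℚᵘ-homo-+ 1ℚ (fromℕ n)) ⟩
  ℚ.toℚᵘ (1ℚ ℚ.+ fromℕ n)              ∎)
  where
  open ℚᵘₚ.≃-Reasoning
  frac : ℕ → ℚᵘ.ℚᵘ
  frac k = ℚᵘ.mkℚᵘ (ℤ.+ k) 0
  arith : ∀ n → (2 + n) * 1 ≡ (1 + (1 + n) * 1) * 1
  arith = solve-∀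
  frac-suc : ∀ n → frac (suc n) ℚᵘ.≃ frac 1 ℚᵘ.+ frac n
  frac-suc zero    = ℚᵘ.*≡* refl
  frac-suc (suc n) = ℚᵘ.*≡* (cong ℤ.+_ (arith n))

shift-double : ∀ a n → shift a (n * 2) ≡ a ℚ.+ fromℕ n
shift-double a zero    = sym (ℚₚ.+-identityʳ a)
shift-double a (suc n) = begin
  shift (a ⁺ ⁺) (n * 2)        ≡⟨ shift-double (a ⁺ ⁺) n ⟩
  a ⁺ ⁺ ℚ.+ fromℕ n            ≡⟨ cong (ℚ._+ fromℕ n) (sym (+1≡⁺⁺ a)) ⟩
  a ℚ.+ 1ℚ ℚ.+ fromℕ n         ≡⟨ ℚₚ.+-assoc a 1ℚ (fromℕ n) ⟩
  a ℚ.+ (1ℚ ℚ.+ fromℕ n)       ≡⟨ cong (a ℚ.+_) (sym (fromℕ-suc n)) ⟩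
  a ℚ.+ fromℕ (suc n)          ∎
  where open ≡-Reasoning

dense-below : ∀ {u v w} → u ℚ.< v → u ℚ.< w → ∃[ p ] (u ℚ.< p × p ℚ.< v × p ℚ.< w)
dense-below {u} {v} {w} u<v u<w with v ℚ.≤? w
... | yes v≤w = let p , u<p , p<v = ℚₚ.<-dense u<v in p , u<p , p<v , ℚₚ.<-≤-trans p<v v≤w
... | no  v≰w = let p , u<p , p<w = ℚₚ.<-dense u<w in p , u<p , ℚₚ.<-trans p<w (ℚₚ.≰⇒> v≰w) , p<w

-- Tilings of an arbitrary interval

LeftToRight : List Tile → Set
LeftToRight = AllPairs (λ s t → start s ℚ.< start t)

-- Cutting tiles off the left of a board leaves an interval that may start at a half-integer, so the
-- induction needs free end points.
record Tiling (u w : ℚ) (T : List Tile) : Set where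
  field
    ordered   : LeftToRight T
    within    : ∀ {t} → t ∈ T → ∀ p → Covers t p → u ℚ.≤ p × p ℚ.≤ w
    covered   : ∀ p → u ℚ.< p → p ℚ.< w → ∃[ t ] (t ∈ T × Covers t p)
    noOverlap : ∀ {s t} → s ∈ T → t ∈ T →
                ∀ p → CoversInside s p → CoversInside t p → s ≡ t

open Tiling

toTiling : ∀ {n T} → IsTiling n T → Tiling 0ℚ (fromℕ n) T
toTiling τ = record { IsTiling τ }

fromTiling : ∀ {n T} → Tiling 0ℚ (fromℕ n) T → IsTiling n T
fromTiling τ = record { Tiling τ }

start∈posts : ∀ t → start t ∈ posts t
start∈posts (halfSquare at x) = here refl
start∈posts (fence      at x) = here refl

start≤post : ∀ t {c} → c ∈ posts t → start t ℚ.≤ c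
start≤post (halfSquare at x) (here refl)         = ℚₚ.≤-refl
start≤post (fence      at x) (here refl)         = ℚₚ.≤-refl
start≤post (fence      at x) (there (here refl)) =
  subst (x ℚ.≤_) (sym (+1≡⁺⁺ x)) (≤-shift x 2)

start≤covered : ∀ t {p} → Covers t p → start t ℚ.≤ p
start≤covered t c = let b , b∈ , b≤p , _ = find c in ℚₚ.≤-trans (start≤post t b∈) b≤p

covers-left : ∀ t {c} → c ∈ posts t → Covers t c
covers-left t {c} c∈ = lose c∈ (ℚₚ.≤-refl , a≤a⁺ c)

covers-right : ∀ t {c} → c ∈ posts t → Covers t (c ⁺)
covers-right t {c} c∈ = lose c∈ (a≤a⁺ c , ℚₚ.≤-refl)

-- `a ℚ.+ 1ℚ` does not reduce to `a ⁺ ⁺`; rewriting here lets later arguments proceed in steps of ½.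
posts-fence : ∀ a → posts (fence at a) ≡ a ∷ a ⁺ ⁺ ∷ []
posts-fence a = cong (λ b → a ∷ b ∷ []) (+1≡⁺⁺ a)

fence-post₂ : ∀ a → a ⁺ ⁺ ∈ posts (fence at a)
fence-post₂ a = subst (a ⁺ ⁺ ∈_) (sym (posts-fence a)) (there (here refl))

fence-posts⁻ : ∀ {a} (P : ℚ → Set) → Any P (posts (fence at a)) → P a ⊎ P (a ⁺ ⁺)
fence-posts⁻ {a} P c with subst (Any P) (posts-fence a) c
... | here q         = inj₁ q
... | there (here q) = inj₂ q

post≥left : ∀ {u w T t c} → Tiling u w T → t ∈ T → c ∈ posts t → u ℚ.≤ c
post≥left {t = t} τ t∈ c∈ = proj₁ (within τ t∈ _ (covers-left t c∈))

post≤right : ∀ {u w T t c} → Tiling u w T → t ∈ T → c ∈ posts t → c ⁺ ℚ.≤ w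
post≤right {t = t} τ t∈ c∈ = proj₂ (within τ t∈ _ (covers-right t c∈))

start≥left : ∀ {u w T t} → Tiling u w T → t ∈ T → u ℚ.≤ start t
start≥left τ t∈ = post≥left τ t∈ (start∈posts _)

-- All posts have width ½, so if `b ≤ c < b ⁺`, a point just right of `c` would be inside both
-- tiles.
posts-apart : ∀ {u w T s t b c} → Tiling u w T → s ∈ T → t ∈ T → s ≢ t →
              b ∈ posts s → c ∈ posts t → b ℚ.≤ c → b ⁺ ℚ.≤ c
posts-apart {b = b} {c} τ s∈ t∈ s≢t b∈ c∈ b≤c = ℚₚ.≮⇒≥ λ c<b⁺ →
  let p , c<p , p<b⁺ = ℚₚ.<-dense c<b⁺ in
  s≢t (noOverlap τ s∈ t∈ p
         (lose b∈ (ℚₚ.≤-<-trans b≤c c<p , p<b⁺))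
         (lose c∈ (c<p , ℚₚ.<-≤-trans p<b⁺ (⁺-mono-≤ b≤c))))

start<⇒≢ : ∀ {s t} → start s ℚ.< start t → s ≢ t
start<⇒≢ s<t refl = ℚₚ.<-irrefl refl s<t

-- If the first tile started right of `u`, then so would all others, and points just right of `u`
-- would be uncovered. Coverage is assumed up to `v` only, so that the lemma also applies to the gap
-- of a fence, where the remaining tiles do not tile an interval.
leftmost : ∀ {u v T} → u ℚ.< v → LeftToRight T → (∀ {t} → t ∈ T → u ℚ.≤ start t) →
           (∀ p → u ℚ.< p → p ℚ.< v → ∃[ t ] (t ∈ T × Covers t p)) →
           ∃₂ λ sh U → T ≡ (sh at u) ∷ U
leftmost {T = []} u<v _ _ cov =
  let p , u<p , p<v = ℚₚ.<-dense u<v in case cov p u<p p<v of λ { (_ , () , _) }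
leftmost {u} {T = (sh at x) ∷ U} u<v (x< ∷ _) u≤ cov with x ℚ.≤? u
... | yes x≤u = sh , U , cong (λ y → (sh at y) ∷ U) (ℚₚ.≤-antisym x≤u (u≤ (here refl)))
... | no  x≰u with p , u<p , p<x , p<v ← dense-below (ℚₚ.≰⇒> x≰u) u<v
              with t , t∈ , c ← cov p u<p p<v =
  contradiction (ℚₚ.≤-trans (x≤start t∈) (start≤covered t c)) (<⇒≱ p<x)
  where
  x≤start : ∀ {t} → t ∈ (sh at x) ∷ U → x ℚ.≤ start t
  x≤start (here refl) = ℚₚ.≤-refl
  x≤start (there t∈)  = ℚₚ.<⇒≤ (All.lookup x< t∈)

-- The prefix is a list because a fence can only be removed together with the tile in its gap:
-- otherwise no point `v` separates the two parts.
drop-prefix : ∀ {u v w} S {T} → u ℚ.≤ v → Tiling u w (S ++ T) →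
              (∀ {s p} → s ∈ S → Covers s p → p ℚ.≤ v) →
              (∀ {t c} → t ∈ T → c ∈ posts t → v ℚ.≤ c) → Tiling v w T
drop-prefix S u≤v τ S≤v v≤T = record
  { ordered   = suffix-ordered S (ordered τ)
  ; within    = λ t∈ p c →
      (let b , b∈ , b≤p , _ = find c in ℚₚ.≤-trans (v≤T t∈ b∈) b≤p)
      , proj₂ (within τ (∈-++⁺ʳ S t∈) p c)
  ; covered   = λ p v<p p<w → case covered τ p (ℚₚ.≤-<-trans u≤v v<p) p<w of λ
      (t , t∈ , c) → case ∈-++⁻ S t∈ of λ
        { (inj₁ t∈S) → contradiction (S≤v t∈S c) (<⇒≱ v<p)
        ; (inj₂ t∈T) → t , t∈T , c }
  ; noOverlap = λ s∈ t∈ → noOverlap τ (∈-++⁺ʳ S s∈) (∈-++⁺ʳ S t∈)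
  }
  where
  suffix-ordered : ∀ S {T} → LeftToRight (S ++ T) → LeftToRight T
  suffix-ordered []      o       = o
  suffix-ordered (_ ∷ S) (_ ∷ o) = suffix-ordered S o

-- The point v has to be covered explicitly, as the field covered of the two
-- parts only concerns interior points.
++-tiling : ∀ {u v w S T} → u ℚ.≤ v → v ℚ.≤ w → Tiling u v S → Tiling v w T →
            ∃[ s ] (s ∈ S × Covers s v) → Tiling u w (S ++ T)
++-tiling {u} {v} {w} {S} {T} u≤v v≤w σ τ atv = record
  { ordered   = AllPairsₚ.++⁺ (ordered σ) (ordered τ)
      (All.tabulate λ s∈ → All.tabulate λ t∈ →
        ℚₚ.<-≤-trans (a<a⁺ _)
          (ℚₚ.≤-trans (post≤right σ s∈ (start∈posts _)) (start≥left τ t∈)))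
  ; within    = λ t∈ p c → case ∈-++⁻ S t∈ of λ
      { (inj₁ t∈S) → let l , r = within σ t∈S p c in l , ℚₚ.≤-trans r v≤w
      ; (inj₂ t∈T) → let l , r = within τ t∈T p c in ℚₚ.≤-trans u≤v l , r }
  ; covered   = cov
  ; noOverlap = λ s∈ t∈ p cs ct → case ∈-++⁻ S s∈ , ∈-++⁻ S t∈ of λ
      { (inj₁ s∈S , inj₁ t∈S) → noOverlap σ s∈S t∈S p cs ct
      ; (inj₁ s∈S , inj₂ t∈T) → ⊥-elim (separate s∈S t∈T cs ct)
      ; (inj₂ s∈T , inj₁ t∈S) → ⊥-elim (separate t∈S s∈T ct cs)
      ; (inj₂ s∈T , inj₂ t∈T) → noOverlap τ s∈T t∈T p cs ct }
  }
  where
  separate : ∀ {s t p} → s ∈ S → t ∈ T → CoversInside s p → CoversInside t p → ⊥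
  separate s∈ t∈ cs ct with b , b∈ , _ , p<b⁺ ← find cs | c , c∈ , c<p , _ ← find ct =
    ℚₚ.<-asym c<p
      (ℚₚ.<-≤-trans p<b⁺ (ℚₚ.≤-trans (post≤right σ s∈ b∈) (post≥left τ t∈ c∈)))

  cov : ∀ p → u ℚ.< p → p ℚ.< w → ∃[ t ] (t ∈ S ++ T × Covers t p)
  cov p u<p p<w with p ℚ.≤? v
  ... | no p≰v = let t , t∈ , c = covered τ p (ℚₚ.≰⇒> p≰v) p<w in t , ∈-++⁺ʳ S t∈ , c
  ... | yes p≤v with v ℚ.≤? p
  ...   | no v≰p  = let t , t∈ , c = covered σ p u<p (ℚₚ.≰⇒> v≰p) in t , ∈-++⁺ˡ t∈ , c
  ...   | yes v≤p = let t , t∈ , c = atv in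
                    t , ∈-++⁺ˡ t∈ , subst (Covers t) (ℚₚ.≤-antisym v≤p p≤v) c

-- Bifence-free tilings as sequences of blocks

-- The tiles of a row of m half-cells starting at a, cut into half-squares and
-- filled fences (fences whose gap is covered by a half-square).
data Blocks : ℕ → ℚ → List Tile → Set where
  []      : ∀ {a} → Blocks 0 a []
  half∷   : ∀ {m a T} → Blocks m (a ⁺) T → Blocks (suc m) a ((halfSquare at a) ∷ T)
  filled∷ : ∀ {m a T} → Blocks m (a ⁺ ⁺ ⁺) T →
            Blocks (suc (suc (suc m))) a ((fence at a) ∷ (halfSquare at (a ⁺)) ∷ T)

half-tiling : ∀ a → Tiling a (a ⁺) ((halfSquare at a) ∷ [])
half-tiling a = record
  { ordered   = [] ∷ []
  ; within    = λ { (here refl) p (here c) → c }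
  ; covered   = λ p a<p p<a⁺ → _ , here refl , here (ℚₚ.<⇒≤ a<p , ℚₚ.<⇒≤ p<a⁺)
  ; noOverlap = λ { (here refl) (here refl) _ _ _ → refl }
  }

filled-tiling : ∀ a → Tiling a (a ⁺ ⁺ ⁺) ((fence at a) ∷ (halfSquare at (a ⁺)) ∷ [])
filled-tiling a = record
  { ordered   = (a<a⁺ a ∷ []) ∷ [] ∷ []
  ; within    = wit
  ; covered   = cov
  ; noOverlap = λ
      { (here refl) (here refl) _ _ _ → refl
      ; (here refl) (there (here refl)) _ cs ct → ⊥-elim (separate cs ct)
      ; (there (here refl)) (here refl) _ cs ct → ⊥-elim (separate ct cs)
      ; (there (here refl)) (there (here refl)) _ _ _ → refl }
  }
  where
  T : List Tile
  T = (fence at a) ∷ (halfSquare at (a ⁺)) ∷ []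

  wit : ∀ {t} → t ∈ T → ∀ p → Covers t p → a ℚ.≤ p × p ℚ.≤ a ⁺ ⁺ ⁺
  wit (here refl) p c with fence-posts⁻ _ c
  ... | inj₁ (l , r) = l , ℚₚ.≤-trans r (≤-shift (a ⁺) 2)
  ... | inj₂ (l , r) = ℚₚ.≤-trans (≤-shift a 2) l , r
  wit (there (here refl)) p (here (l , r)) = ℚₚ.≤-trans (a≤a⁺ a) l , ℚₚ.≤-trans r (a≤a⁺ _)

  cov : ∀ p → a ℚ.< p → p ℚ.< a ⁺ ⁺ ⁺ → ∃[ t ] (t ∈ T × Covers t p)
  cov p a<p p<e with p ℚ.≤? a ⁺ | p ℚ.≤? a ⁺ ⁺
  ... | yes p≤ | _      = _ , here refl , here (ℚₚ.<⇒≤ a<p , p≤)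
  ... | no p≰  | yes p≤ = _ , there (here refl) , here (ℚₚ.<⇒≤ (ℚₚ.≰⇒> p≰) , p≤)
  ... | no _   | no p≰  =
    _ , here refl , lose (fence-post₂ a) (ℚₚ.<⇒≤ (ℚₚ.≰⇒> p≰) , ℚₚ.<⇒≤ p<e)

  separate : ∀ {p} → CoversInside (fence at a) p → CoversInside (halfSquare at (a ⁺)) p → ⊥
  separate cs (here (l , r)) with fence-posts⁻ _ cs
  ... | inj₁ (_ , r′) = ℚₚ.<-asym l r′
  ... | inj₂ (l′ , _) = ℚₚ.<-asym r l′

blocks⇒tiling : ∀ {m a T} → Blocks m a T → Tiling a (shift a m) T
blocks⇒tiling {a = a} [] = record
  { ordered   = []
  ; within    = λ ()
  ; covered   = λ p a<p p<a → ⊥-elim (ℚₚ.<-asym a<p p<a)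
  ; noOverlap = λ ()
  }
blocks⇒tiling {suc m} {a} (half∷ β) =
  ++-tiling (a≤a⁺ a) (≤-shift (a ⁺) m) (half-tiling a) (blocks⇒tiling β)
    (_ , here refl , covers-right (halfSquare at a) (here refl))
blocks⇒tiling {suc (suc (suc m))} {a} (filled∷ β) =
  ++-tiling (≤-shift a 3) (≤-shift (a ⁺ ⁺ ⁺) m) (filled-tiling a) (blocks⇒tiling β)
    (_ , here refl , covers-right (fence at a) (fence-post₂ a))

-- A fence at `a` would need a partner at `a ⁺`, but a half-square starts there and all further
-- tiles start at `a ⁺ ⁺ ⁺` or later.
blocks⇒¬bifence : ∀ {m a T} → Blocks m a T → ¬ HasBifence T
blocks⇒¬bifence (half∷ β) (x , there p , there q) = blocks⇒¬bifence β (x , p , q)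
blocks⇒¬bifence {a = a} (filled∷ β) (x , p , q) = go p q refl
  where
  -- Phrased with y in place of x ⁺, so that membership can be matched on.
  go : ∀ {y} → (fence at x) ∈ _ → (fence at y) ∈ _ → y ≡ x ⁺ → ⊥
  go (here refl) (here refl) e = ℚₚ.<-irrefl e (a<a⁺ a)
  go (here refl) (there (there q)) refl =
    <⇒≱ (a<a⁺ (a ⁺)) (ℚₚ.≤-trans (a≤a⁺ (a ⁺ ⁺)) (start≥left (blocks⇒tiling β) q))
  go (there (there p)) (here refl) e =
    <⇒≱ (subst (x ℚ.<_) (sym e) (a<a⁺ x))
      (ℚₚ.≤-trans (≤-shift a 3) (start≥left (blocks⇒tiling β) p))
  go (there (there p)) (there (there q)) refl = blocks⇒¬bifence β (x , p , q)

tail-bifence : ∀ {t T} → HasBifence T → HasBifence (t ∷ T)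
tail-bifence (x , p , q) = x , there p , there q

-- The first tile after a starting fence is flush with the gap of the fence,
-- and must be a half-square since a fence there would complete a bifence.
tiling⇒blocks : ∀ m {a T} → Tiling a (shift a m) T → ¬ HasBifence T → Blocks m a T
tiling⇒blocks zero {T = []}    τ _ = []
tiling⇒blocks zero {T = t ∷ _} τ _ =
  contradiction (ℚₚ.≤-trans (post≤right τ (here refl) (start∈posts t)) (start≥left τ (here refl)))
    (<⇒≱ (a<a⁺ _))
tiling⇒blocks (suc m) {a} τ nb
  with leftmost (ℚₚ.<-≤-trans (a<a⁺ a) (≤-shift (a ⁺) m)) (ordered τ) (start≥left τ) (covered τ)
... | halfSquare , U , refl =
  half∷ (tiling⇒blocks m
    (drop-prefix ((halfSquare at a) ∷ []) (a≤a⁺ a) τ (λ { (here refl) (here (_ , r)) → r }) U≥)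
    (nb ∘ tail-bifence))
  where
  U≥ : ∀ {t c} → t ∈ U → c ∈ posts t → a ⁺ ℚ.≤ c
  U≥ {t} t∈ c∈ = posts-apart τ (here refl) (there t∈)
    (start<⇒≢ (All.lookup (AllPairs.head (ordered τ)) t∈))
    (here refl) c∈ (post≥left τ (there t∈) c∈)
-- The fence would end at `a ⁺ ⁺ ⁺`, beyond a row of one or two half-cells.
tiling⇒blocks (suc zero) {a} τ nb | fence , U , refl =
  contradiction (post≤right τ (here refl) (fence-post₂ a))
    (<⇒≱ (ℚₚ.<-≤-trans (a<a⁺ (a ⁺)) (a≤a⁺ (a ⁺ ⁺))))
tiling⇒blocks (suc (suc zero)) {a} τ nb | fence , U , refl =
  contradiction (post≤right τ (here refl) (fence-post₂ a)) (<⇒≱ (a<a⁺ (a ⁺ ⁺)))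
tiling⇒blocks (suc (suc (suc m))) {a} τ nb | fence , U , refl
  with leftmost (a<a⁺ (a ⁺)) (AllPairs.tail (ordered τ)) (λ t∈ → U≥ t∈ (start∈posts _)) U-covers
  where
  U≥ : ∀ {t c} → t ∈ U → c ∈ posts t → a ⁺ ℚ.≤ c
  U≥ {t} t∈ c∈ = posts-apart τ (here refl) (there t∈)
    (start<⇒≢ (All.lookup (AllPairs.head (ordered τ)) t∈))
    (here refl) c∈ (post≥left τ (there t∈) c∈)

  -- Neither post of the fence reaches into the interior of its gap, so the tile covering a point
  -- there lies in `U`.
  U-covers : ∀ p → a ⁺ ℚ.< p → p ℚ.< a ⁺ ⁺ → ∃[ t ] (t ∈ U × Covers t p)
  U-covers p l r
    with covered τ p (ℚₚ.<-trans (a<a⁺ a) l) (ℚₚ.<-≤-trans r (≤-shift (a ⁺ ⁺) (suc m)))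
  ... | t , there t∈ , c = t , t∈ , c
  ... | _ , here refl , c with fence-posts⁻ _ c
  ...   | inj₁ (_ , r′) = contradiction r′ (<⇒≱ l)
  ...   | inj₂ (l′ , _) = contradiction l′ (<⇒≱ r)
... | fence , V , refl = contradiction (a , here refl , there (here refl)) nb
... | halfSquare , V , refl =
  filled∷ (tiling⇒blocks m
    (drop-prefix ((fence at a) ∷ (halfSquare at (a ⁺)) ∷ []) (≤-shift a 3) τ prefix≤ V≥)
    (nb ∘ tail-bifence ∘ tail-bifence))
  where
  prefix≤ : ∀ {s p} → s ∈ (fence at a) ∷ (halfSquare at (a ⁺)) ∷ [] → Covers s p → p ℚ.≤ a ⁺ ⁺ ⁺
  prefix≤ s∈ c = proj₂ (within (filled-tiling a) s∈ _ c)

  V≥ : ∀ {t c} → t ∈ V → c ∈ posts t → a ⁺ ⁺ ⁺ ℚ.≤ c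
  -- The half-square in the gap first pushes `c` to at least `a ⁺ ⁺`; the second post of the fence
  -- then pushes it to `a ⁺ ⁺ ⁺`.
  V≥ {t} t∈ c∈ = posts-apart τ (here refl) (there (there t∈))
    (start<⇒≢ (All.lookup (AllPairs.head (ordered τ)) (there t∈))) (fence-post₂ a) c∈
    (posts-apart τ (there (here refl)) (there (there t∈)) (start<⇒≢ a⁺<t) (here refl) c∈
      (ℚₚ.≤-trans (ℚₚ.<⇒≤ a⁺<t) (start≤post t c∈)))
    where
    a⁺<t : a ⁺ ℚ.< start t
    a⁺<t = All.lookup (AllPairs.head (AllPairs.tail (ordered τ))) t∈

-- Counting

halfFirst filledFirst : ℚ → List Tile → List Tile
halfFirst   a T = (halfSquare at a) ∷ T
filledFirst a T = (fence at a) ∷ (halfSquare at (a ⁺)) ∷ T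

blocks : ℕ → ℚ → List (List Tile)
blocks 0                   a = [] ∷ []
blocks 1                   a = map (halfFirst a) (blocks 0 (a ⁺))
blocks 2                   a = map (halfFirst a) (blocks 1 (a ⁺))
blocks (suc (suc (suc m))) a =
  map (halfFirst a) (blocks (suc (suc m)) (a ⁺)) ++ map (filledFirst a) (blocks m (a ⁺ ⁺ ⁺))

blocks-sound : ∀ m {a T} → T ∈ blocks m a → Blocks m a T
blocks-sound 0 (here refl) = []
blocks-sound 1 {a} T∈ with _ , U∈ , refl ← ∈-map⁻ (halfFirst a) T∈ = half∷ (blocks-sound 0 U∈)
blocks-sound 2 {a} T∈ with _ , U∈ , refl ← ∈-map⁻ (halfFirst a) T∈ = half∷ (blocks-sound 1 U∈)
blocks-sound (suc (suc (suc m))) {a} T∈ with ∈-++⁻ (map (halfFirst a) (blocks (suc (suc m)) (a ⁺))) T∈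
... | inj₁ p with _ , U∈ , refl ← ∈-map⁻ (halfFirst a) p = half∷ (blocks-sound (suc (suc m)) U∈)
... | inj₂ p with _ , U∈ , refl ← ∈-map⁻ (filledFirst a) p = filled∷ (blocks-sound m U∈)

blocks-complete : ∀ {m a T} → Blocks m a T → T ∈ blocks m a
blocks-complete []                                  = here refl
blocks-complete {suc zero}              (half∷ β)   = ∈-map⁺ (halfFirst _) (blocks-complete β)
blocks-complete {suc (suc zero)}        (half∷ β)   = ∈-map⁺ (halfFirst _) (blocks-complete β)
blocks-complete {suc (suc (suc m))}     (half∷ β)   =
  ∈-++⁺ˡ (∈-map⁺ (halfFirst _) (blocks-complete β))
blocks-complete {suc (suc (suc m))} {a} (filled∷ β) =
  ∈-++⁺ʳ (map (halfFirst a) (blocks (suc (suc m)) (a ⁺)))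
    (∈-map⁺ (filledFirst a) (blocks-complete β))

blocks-unique : ∀ m a → Unique (blocks m a)
blocks-unique 0 a = [] ∷ []
blocks-unique 1 a = Uniqueₚ.map⁺ {f = halfFirst a} ∷-injectiveʳ (blocks-unique 0 (a ⁺))
blocks-unique 2 a = Uniqueₚ.map⁺ {f = halfFirst a} ∷-injectiveʳ (blocks-unique 1 (a ⁺))
blocks-unique (suc (suc (suc m))) a = Uniqueₚ.++⁺
  (Uniqueₚ.map⁺ ∷-injectiveʳ (blocks-unique (suc (suc m)) (a ⁺)))
  (Uniqueₚ.map⁺ (∷-injectiveʳ ∘ ∷-injectiveʳ) (blocks-unique m (a ⁺ ⁺ ⁺)))
  λ (p , q) → case ∈-map⁻ (halfFirst a) p , ∈-map⁻ (filledFirst a) q of λ { ((_ , _ , refl) , (_ , _ , ())) }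

-- Narayana's cows sequence 1, 1, 1, 2, 3, 4, 6, 9, ...
blockCount : ℕ → ℕ
blockCount 0                   = 1
blockCount 1                   = 1
blockCount 2                   = 1
blockCount (suc (suc (suc m))) = blockCount (suc (suc m)) + blockCount m

length-blocks : ∀ m a → length (blocks m a) ≡ blockCount m
length-blocks 0 a = refl
length-blocks 1 a = refl
length-blocks 2 a = refl
length-blocks (suc (suc (suc m))) a = trans
  (length-++ (map (halfFirst a) (blocks (suc (suc m)) (a ⁺))))
  (cong₂ _+_
    (trans (length-map (halfFirst a) (blocks (suc (suc m)) (a ⁺))) (length-blocks (suc (suc m)) (a ⁺)))
    (trans (length-map (filledFirst a) (blocks m (a ⁺ ⁺ ⁺))) (length-blocks m (a ⁺ ⁺ ⁺))))

C : ℕ → ℕ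
C n = blockCount (n * 2)

bifenceFree-count : ∀ n → HasCount (IsBifenceFreeTiling n) (C n)
bifenceFree-count n =
  blocks (n * 2) 0ℚ , blocks-unique (n * 2) 0ℚ ,
  (λ T → mk⇔
    (λ T∈ → let β = blocks-sound (n * 2) T∈ in
      fromTiling (subst (λ w → Tiling 0ℚ w T) end (blocks⇒tiling β)) , blocks⇒¬bifence β)
    (λ (τ , nb) → blocks-complete
      (tiling⇒blocks (n * 2) (subst (λ w → Tiling 0ℚ w T) (sym end) (toTiling τ)) nb))) ,
  length-blocks (n * 2) 0ℚ
  where
  end : shift 0ℚ (n * 2) ≡ fromℕ n
  end = trans (shift-double 0ℚ n) (ℚₚ.+-identityˡ (fromℕ n))

-- With b for `blockCount` and m = 2n, unfolding gives b(m+6) = b(m+5) + b(m+3) = (b(m+4) + b(m+2))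
-- + (b(m+2) + b(m)).
C-rec : ∀ n → C (3 + n) ≡ C (2 + n) + 2 * C (1 + n) + C n
C-rec n = arith (blockCount (4 + n * 2)) (C (1 + n)) (C n)
  where
  arith : ∀ x y z → x + y + (y + z) ≡ x + 2 * y + z
  arith = solve-∀

-- The identity

conv : (ℕ → ℕ) → (ℕ → ℕ) → ℕ → ℕ
conv c d n = sum (applyUpTo (λ i → c i * d (n ∸ i)) (suc n))

-- The generating function of `C` is 1/(1 - x - 2x² - x³), so convolution with `C` solves the
-- recurrence with inhomogeneous term `c`. The induction splits off the term of `c 0` and continues
-- with `c ∘ suc`.
conv-C-rec : ∀ c n → conv c C (3 + n) ≡
             conv c C (2 + n) + 2 * conv c C (1 + n) + conv c C n + c (3 + n)
conv-C-rec c zero = arith (c 0) (c 1) (c 2) (c 3)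
  where
  -- The constants 6, 3, 1, 1 are the values of `C` at 3, 2, 1, 0.
  arith : ∀ c₀ c₁ c₂ c₃ →
    c₀ * 6 + (c₁ * 3 + (c₂ * 1 + (c₃ * 1 + 0))) ≡
    c₀ * 3 + (c₁ * 1 + (c₂ * 1 + 0)) + 2 * (c₀ * 1 + (c₁ * 1 + 0)) + (c₀ * 1 + 0) + c₃
  arith = solve-∀
conv-C-rec c (suc n) = trans
  (cong₂ (λ x y → c 0 * x + y) (C-rec (suc n)) (conv-C-rec (c ∘ suc) n))
  (arith (c 0) (C (3 + n)) (C (2 + n)) (C (1 + n)) _ _ _ (c (4 + n)))
  where
  arith : ∀ c₀ x y z p q r e →
    c₀ * (x + 2 * y + z) + (p + 2 * q + r + e) ≡
    c₀ * x + p + 2 * (c₀ * y + q) + (c₀ * z + r) + e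
  arith = solve-∀

-- The separate value at 0 avoids F(-1), which would be multiplied by `F 0`, that is, by 0.
coeff : ℕ → ℕ
coeff zero    = 1
coeff (suc j) = F (2 + j) ^ 2 + F (1 + j) ^ 2 + 2 * (F j * F (1 + j))

-- Both sides satisfy the recurrence of `C` with the same inhomogeneous term `coeff (3 + n)`, and
-- they agree at three initial values.
F²-convolution : ∀ n → F (3 + n) ^ 2 ≡ C (2 + n) + conv coeff C n
F²-convolution 0 = refl
F²-convolution 1 = refl
F²-convolution 2 = refl
F²-convolution (suc (suc (suc n))) = begin
  F (6 + n) ^ 2
    ≡⟨ fib (F (2 + n)) (F (3 + n)) ⟩
  F (5 + n) ^ 2 + 2 * F (4 + n) ^ 2 + F (3 + n) ^ 2 + coeff (3 + n)
    ≡⟨ cong (_+ coeff (3 + n)) (cong₂ _+_ (cong₂ (λ x y → x + 2 * y)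
         (F²-convolution (suc (suc n))) (F²-convolution (suc n))) (F²-convolution n)) ⟩
  (C (4 + n) + conv coeff C (2 + n)) + 2 * (C (3 + n) + conv coeff C (1 + n))
    + (C (2 + n) + conv coeff C n) + coeff (3 + n)
    ≡⟨ arith (C (4 + n)) (C (3 + n)) (C (2 + n)) (conv coeff C (2 + n)) (conv coeff C (1 + n))
         (conv coeff C n) (coeff (3 + n)) ⟩
  (C (4 + n) + 2 * C (3 + n) + C (2 + n))
    + (conv coeff C (2 + n) + 2 * conv coeff C (1 + n) + conv coeff C n + coeff (3 + n))
    ≡⟨ sym (cong₂ _+_ (C-rec (2 + n)) (conv-C-rec coeff n)) ⟩
  C (5 + n) + conv coeff C (3 + n) ∎
  where
  open ≡-Reasoning
  -- `a` to `e` are `F (2 + n)` to `F (6 + n)`; `x * (x * 1)` is what `x ^ 2` reduces to.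
  fib : ∀ a b → let c = b + a ; d = c + b ; e = d + c in
        e * (e * 1) ≡ d * (d * 1) + 2 * (c * (c * 1)) + b * (b * 1)
                      + (c * (c * 1) + b * (b * 1) + 2 * (a * b))
  fib = solve-∀
  arith : ∀ x y z p q r e →
    (x + p) + 2 * (y + q) + (z + r) + e ≡ (x + 2 * y + z) + (p + 2 * q + r + e)
  arith = solve-∀

sumFromTo-applyUpTo : ∀ a b f → sumFromTo a b f ≡ sum (applyUpTo (λ i → f (a + i)) (suc b ∸ a))
sumFromTo-applyUpTo a b f = cong sum (map-upTo (λ i → f (a + i)) (suc b ∸ a))

sum-cong : ∀ {f g : ℕ → ℕ} → (∀ i → f i ≡ g i) → ∀ n → sum (applyUpTo f n) ≡ sum (applyUpTo g n)
sum-cong eq zero    = refl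
sum-cong eq (suc n) = cong₂ _+_ (eq 0) (sum-cong (eq ∘ suc) n)

sum-+ : ∀ (f g : ℕ → ℕ) n →
        sum (applyUpTo f n) + sum (applyUpTo g n) ≡ sum (applyUpTo (λ i → f i + g i) n)
sum-+ f g zero    = refl
sum-+ f g (suc n) = trans (arith (f 0) _ (g 0) _) (cong (f 0 + g 0 +_) (sum-+ (f ∘ suc) (g ∘ suc) n))
  where
  arith : ∀ a b c d → a + b + (c + d) ≡ a + c + (b + d)
  arith = solve-∀

sum-*ʳ : ∀ (f : ℕ → ℕ) c n → sum (applyUpTo (λ i → f i * c) n) ≡ sum (applyUpTo f n) * c
sum-*ʳ f c zero    = refl
sum-*ʳ f c (suc n) = trans (cong (f 0 * c +_) (sum-*ʳ (f ∘ suc) c n)) (sym (ℕₚ.*-distribʳ-+ c (f 0) _))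

-- Twice the classical sum of squares of `F 1` to `F (1 + m)`; the largest comes first, so induction
-- removes the head.
sum-2F² : ∀ m → sum (applyUpTo (λ i → 2 * F (m ∸ i + 1) ^ 2) (suc m)) ≡ 2 * (F (1 + m) * F (2 + m))
sum-2F² zero    = refl
sum-2F² (suc m) = trans
  (cong₂ _+_ (cong (λ k → 2 * F k ^ 2) (ℕₚ.+-comm (suc m) 1)) (sum-2F² m))
  (arith (F (1 + m)) (F (2 + m)))
  where
  arith : ∀ a b → 2 * (b * (b * 1)) + 2 * (a * b) ≡ 2 * (b * (b + a))
  arith = solve-∀

-- The term `l = 3` has weight 1 and gives `F (1 + j) ^ 2`; the others have weight 2 and run over
-- the squares of `F j` down to `F 1`.
inner-sum : ∀ j c → (∑[ l ∈ 3 ⋯ 3 + j ] ((2 ∸ δ l 3) * F (3 + j ∸ l + 1) ^ 2 * c)) ≡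
            (F (1 + j) ^ 2 + 2 * (F j * F (1 + j))) * c
inner-sum j c = begin
  (∑[ l ∈ 3 ⋯ 3 + j ] ((2 ∸ δ l 3) * F (3 + j ∸ l + 1) ^ 2 * c))
    ≡⟨ sumFromTo-applyUpTo 3 (3 + j) (λ l → (2 ∸ δ l 3) * F (3 + j ∸ l + 1) ^ 2 * c) ⟩
  sum (applyUpTo (λ i → weighted i * c) (suc j))
    ≡⟨ sum-*ʳ weighted c (suc j) ⟩
  sum (applyUpTo weighted (suc j)) * c
    ≡⟨ cong (_* c) (cong₂ _+_ first (rest j)) ⟩
  (F (1 + j) ^ 2 + 2 * (F j * F (1 + j))) * c ∎
  where
  open ≡-Reasoning
  weighted : ℕ → ℕ
  weighted i = (2 ∸ δ (3 + i) 3) * F (j ∸ i + 1) ^ 2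

  first : 1 * F (j + 1) ^ 2 ≡ F (1 + j) ^ 2
  first = trans (ℕₚ.*-identityˡ _) (cong (λ k → F k ^ 2) (ℕₚ.+-comm j 1))

  rest : ∀ j → sum (applyUpTo (λ i → 2 * F (j ∸ suc i + 1) ^ 2) j) ≡ 2 * (F j * F (1 + j))
  rest zero    = refl
  rest (suc m) = sum-2F² m

-- This collects what both sums contribute at `k = 2 + i`. At `i = 0` the range of `l` is empty and
-- only `F 1 ^ 2` is left.
coeff-split : ∀ i c → F (1 + i) ^ 2 * c
                      + (∑[ l ∈ 3 ⋯ 2 + i ] ((2 ∸ δ l 3) * F (2 + i ∸ l + 1) ^ 2 * c)) ≡
              coeff i * c
coeff-split zero    c = ℕₚ.+-identityʳ (1 * c)
coeff-split (suc j) c = begin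
  F (2 + j) ^ 2 * c + (∑[ l ∈ 3 ⋯ 3 + j ] ((2 ∸ δ l 3) * F (3 + j ∸ l + 1) ^ 2 * c))
    ≡⟨ cong (F (2 + j) ^ 2 * c +_) (inner-sum j c) ⟩
  F (2 + j) ^ 2 * c + (F (1 + j) ^ 2 + 2 * (F j * F (1 + j))) * c
    ≡⟨ ℕₚ.*-distribʳ-+ c (F (2 + j) ^ 2) _ ⟨
  (F (2 + j) ^ 2 + (F (1 + j) ^ 2 + 2 * (F j * F (1 + j)))) * c
    ≡⟨ cong (_* c) (ℕₚ.+-assoc (F (2 + j) ^ 2) _ _) ⟨
  coeff (1 + j) * c ∎
  where open ≡-Reasoning

F²-identity : ∀ n →
  F (n + 1) ^ 2 ≡
    C n
    + (∑[ k ∈ 2 ⋯ n ] (F (k ∸ 1) ^ 2 * C (n ∸ k)))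
    + (∑[ k ∈ 3 ⋯ n ] (∑[ l ∈ 3 ⋯ k ] ((2 ∸ δ l 3) * F (k ∸ l + 1) ^ 2 * C (n ∸ k))))
-- Below `n = 2` both sums are empty.
F²-identity 0             = refl
F²-identity 1             = refl
F²-identity (suc (suc m)) = begin
  F (2 + m + 1) ^ 2
    ≡⟨ cong (λ k → F k ^ 2) (ℕₚ.+-comm (2 + m) 1) ⟩
  F (3 + m) ^ 2
    ≡⟨ F²-convolution m ⟩
  C (2 + m) + conv coeff C m
    ≡⟨ cong (C (2 + m) +_) (sum-cong (λ i → coeff-split i (C (m ∸ i))) (suc m)) ⟨
  C (2 + m) + sum (applyUpTo (λ i → f (2 + i) + g (2 + i)) (suc m))
    ≡⟨ cong (C (2 + m) +_) (sum-+ (λ i → f (2 + i)) (λ i → g (2 + i)) (suc m)) ⟨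
  -- g 2 is an empty sum, so the second sum may as well start at k = 3.
  C (2 + m) + (sum (applyUpTo (λ i → f (2 + i)) (suc m)) + sum (applyUpTo (λ i → g (3 + i)) m))
    ≡⟨ cong (C (2 + m) +_) (cong₂ _+_ (sumFromTo-applyUpTo 2 (2 + m) f)
                                      (sumFromTo-applyUpTo 3 (2 + m) g)) ⟨
  C (2 + m) + (sumFromTo 2 (2 + m) f + sumFromTo 3 (2 + m) g)
    ≡⟨ ℕₚ.+-assoc (C (2 + m)) _ _ ⟨
  C (2 + m) + sumFromTo 2 (2 + m) f + sumFromTo 3 (2 + m) g ∎
  where
  open ≡-Reasoning
  f g : ℕ → ℕ
  f k = F (k ∸ 1) ^ 2 * C (2 + m ∸ k)
  g k = ∑[ l ∈ 3 ⋯ k ] ((2 ∸ δ l 3) * F (k ∸ l + 1) ^ 2 * C (2 + m ∸ k))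

mainTheorem6 : Σ (ℕ → ℕ) λ C →
    (∀ n → HasCount (IsBifenceFreeTiling n) (C n)) ×
    (∀ n →
    F (n + 1) ^ 2 ≡
    C n
    + (∑[ k ∈ 2 ⋯ n ] (F (k ∸ 1) ^ 2 * C (n ∸ k)))
    + (∑[ k ∈ 3 ⋯ n ] (∑[ l ∈ 3 ⋯ k ] ((2 ∸ δ l 3) * F (k ∸ l + 1) ^ 2 * C (n ∸ k)))))
mainTheorem6 = C , bifenceFree-count , F²-identity
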